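{- Suppose that an extension $L$ of $\mathsf{N4}^\bot$ can be axiomatized as $L=\mathsf{N4}^\bot+X$, where $X$ is a set of formulas each of the form $\psi(p_1,\dots,p_n,\ q_1\vee\sim q_1,\dots,q_m\vee\sim q_m)$ with $\psi(p_1,\dots,p_n,q_1,\dots,q_m)$ a formula in the language $\{\wedge,\vee,\to,\bot\}$ and $\{p_1,\dots,p_n\}\cap\{q_1,\dots,q_m\}=\varnothing$ ($m=0$ allowed). Then $\tau_{\mathbf{B}}L$ is a modal companion of $L$.
   Context: Languages: $\mathcal{L}_\sim=\{\wedge,\vee,\to,\bot,\sim\}$ and $\mathcal{L}^\Box_\sim=\mathcal{L}_\sim\cup\{\Box,\Diamond\}$, formulas over a countable set of variables; $\neg\varphi:=\varphi\to\bot$, $\varphi\leftrightarrow\psi:=(\varphi\to\psi)\wedge(\psi\to\varphi)$, $\varphi\Leftrightarrow\psi:=(\varphi\leftrightarrow\psi)\wedge(\sim\varphi\leftrightarrow\sim\psi)$. A logic in $\mathcal{L}_\sim$ is a set of formulas closed under substitution and modus ponens; a logic in $\mathcal{L}^\Box_\sim$ is additionally closed under $\varphi\to\psi/\Box\varphi\to\Box\psi$ and $\varphi\to\psi/\Diamond\varphi\to\Diamond\psi$. $\mathsf{N4}^\bot$ is the least logic in $\mathcal{L}_\sim$ containing the intuitionistic axioms ($p\to(q\to p)$; $(p\to(q\to r))\to((p\to q)\to(p\to r))$; $p\wedge q\to p$; $p\wedge q\to q$; $p\to(q\to p\wedge q)$; $p\to p\vee q$; $q\to p\vee q$; $(p\to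 r)\to((q\to r)\to(p\vee q\to r))$; $\bot\to p$) and $\sim(p\vee q)\leftrightarrow(\sim p\wedge\sim q)$, $\sim(p\wedge q)\leftrightarrow(\sim p\vee\sim q)$, $\sim(p\to q)\leftrightarrow(p\wedge\sim q)$, $\sim\sim p\leftrightarrow p$, $\sim\bot$. $\mathsf{BS4}$ is the least logic in $\mathcal{L}^\Box_\sim$ containing these axioms, $p\vee\neg p$, $\Box(p\to p)$, $(\Box p\wedge\Box q)\to\Box(p\wedge q)$, $\Box p\to p$, $\Box p\to\Box\Box p$, $\neg\Box p\leftrightarrow\Diamond\neg p$, $\neg\Diamond p\leftrightarrow\Box\neg p$, $\Box p\Leftrightarrow\sim\Diamond\sim p$, $\Diamond p\Leftrightarrow\sim\Box\sim p$. Extensions are logics containing the given one; $L+X$ is the least logic containing $L\cup X$. Translation $\mathrm{T}_{\mathbf{B}}$: $\mathrm{T}_{\mathbf{B}}(p)=\Box p$, $\mathrm{T}_{\mathbf{B}}(\sim p)=\Box\sim p$, $\mathrm{T}_{\mathbf{B}}(\bot)=\bot$, $\mathrm{T}_{\mathbf{B}}(\sim\bot)=\sim\bot$, $\mathrm{T}_{\mathbf{B}}(\varphi\wedge\psi)=\mathrm{T}_{\mathbf{B}}\varphi\wedge\mathrm{T}_{\mathbf{B}}\psi$, $\mathrm{T}_{\mathbf{B}}(\varphi\vee\psi)=\mathrm{T}_{\mathbf{B}}\varphi\vee\mathrm{T}_{\mathbf{B}}\psi$, $\mathrm{T}_{\mathbf{B}}(\varphi\to\psi)=\Box(\mathrm{T}_{\mathbf{B}}\varphi\to\mathrm{T}_{\mathbf{B}}\psi)$,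 $\mathrm{T}_{\mathbf{B}}(\sim(\varphi\wedge\psi))=\mathrm{T}_{\mathbf{B}}(\sim\varphi)\vee\mathrm{T}_{\mathbf{B}}(\sim\psi)$, $\mathrm{T}_{\mathbf{B}}(\sim(\varphi\vee\psi))=\mathrm{T}_{\mathbf{B}}(\sim\varphi)\wedge\mathrm{T}_{\mathbf{B}}(\sim\psi)$, $\mathrm{T}_{\mathbf{B}}(\sim(\varphi\to\psi))=\mathrm{T}_{\mathbf{B}}\varphi\wedge\mathrm{T}_{\mathbf{B}}(\sim\psi)$, $\mathrm{T}_{\mathbf{B}}(\sim\sim\varphi)=\mathrm{T}_{\mathbf{B}}\varphi$. A modal companion of an extension $L$ of $\mathsf{N4}^\bot$ is an extension $M$ of $\mathsf{BS4}$ with $\varphi\in L\iff\mathrm{T}_{\mathbf{B}}\varphi\in M$ for every $\mathcal{L}_\sim$-formula $\varphi$; $\tau_{\mathbf{B}}L:=\mathsf{BS4}+\{\mathrm{T}_{\mathbf{B}}\varphi:\varphi\in L\}$. -}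

module Defs where

open import Data.Nat using (ℕ)
open import Data.Bool using (Bool; if_then_else_)
open import Data.Product using (Σ; _×_)
open import Data.Empty using () renaming (⊥ to Empty)
open import Relation.Binary.PropositionalEquality using (_≡_)

infixr 7 _∧_
infixr 6 _∨_
infixr 5 _⇒_
infix 4 _↔_ _⇔_ _↔ᵐ_ _⇔ᵐ_
infix 9 ∼_ □_ ◇_
infix 8 ¬_ ¬ᵐ_

data Fm : Set where
  var : ℕ → Fm
  ⊥ : Fm
  _∧_ _∨_ _⇒_ : Fm → Fm → Fm
  ∼_ : Fm → Fm

data MFm : Set where
  var : ℕ → MFm
  ⊥ : MFm
  _∧_ _∨_ _⇒_ : MFm → MFm → MFm
  ∼_ □_ ◇_ : MFm → MFm

¬_ : Fm → Fm
¬ φ = φ ⇒ ⊥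
_↔_ : Fm → Fm → Fm
φ ↔ ψ = (φ ⇒ ψ) ∧ (ψ ⇒ φ)
_⇔_ : Fm → Fm → Fm
φ ⇔ ψ = (φ ↔ ψ) ∧ (∼ φ ↔ ∼ ψ)

¬ᵐ_ : MFm → MFm
¬ᵐ φ = φ ⇒ ⊥
_↔ᵐ_ : MFm → MFm → MFm
φ ↔ᵐ ψ = (φ ⇒ ψ) ∧ (ψ ⇒ φ)
_⇔ᵐ_ : MFm → MFm → MFm
φ ⇔ᵐ ψ = (φ ↔ᵐ ψ) ∧ (∼ φ ↔ᵐ ∼ ψ)

substF : (ℕ → Fm) → Fm → Fm
substF σ (var n) = σ n
substF σ ⊥ = ⊥
substF σ (φ ∧ ψ) = substF σ φ ∧ substF σ ψ
substF σ (φ ∨ ψ) = substF σ φ ∨ substF σ ψ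
substF σ (φ ⇒ ψ) = substF σ φ ⇒ substF σ ψ
substF σ (∼ φ) = ∼ substF σ φ

substM : (ℕ → MFm) → MFm → MFm
substM σ (var n) = σ n
substM σ ⊥ = ⊥
substM σ (φ ∧ ψ) = substM σ φ ∧ substM σ ψ
substM σ (φ ∨ ψ) = substM σ φ ∨ substM σ ψ
substM σ (φ ⇒ ψ) = substM σ φ ⇒ substM σ ψ
substM σ (∼ φ) = ∼ substM σ φ
substM σ (□ φ) = □ substM σ φ
substM σ (◇ φ) = ◇ substM σ φ

ι : Fm → MFm
ι (var n) = var n
ι ⊥ = ⊥
ι (φ ∧ ψ) = ι φ ∧ ι ψ
ι (φ ∨ ψ) = ι φ ∨ ι ψ
ι (φ ⇒ ψ) = ι φ ⇒ ι ψ
ι (∼ φ) = ∼ ι φ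

p q r : Fm
p = var 0
q = var 1
r = var 2

data N4Ax : Fm → Set where
  ax1 : N4Ax (p ⇒ (q ⇒ p))
  ax2 : N4Ax ((p ⇒ (q ⇒ r)) ⇒ ((p ⇒ q) ⇒ (p ⇒ r)))
  ax3 : N4Ax (p ∧ q ⇒ p)
  ax4 : N4Ax (p ∧ q ⇒ q)
  ax5 : N4Ax (p ⇒ (q ⇒ p ∧ q))
  ax6 : N4Ax (p ⇒ p ∨ q)
  ax7 : N4Ax (q ⇒ p ∨ q)
  ax8 : N4Ax ((p ⇒ r) ⇒ ((q ⇒ r) ⇒ (p ∨ q ⇒ r)))
  ax9 : N4Ax (⊥ ⇒ p)
  n∨ : N4Ax (∼ (p ∨ q) ↔ (∼ p ∧ ∼ q))
  n∧ : N4Ax (∼ (p ∧ q) ↔ (∼ p ∨ ∼ q))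
  n⇒ : N4Ax (∼ (p ⇒ q) ↔ (p ∧ ∼ q))
  n∼ : N4Ax (∼ ∼ p ↔ p)
  n⊥ : N4Ax (∼ ⊥)

data N4+ (X : Fm → Set) : Fm → Set where
  ax  : ∀ {φ} → N4Ax φ → N4+ X φ
  hyp : ∀ {φ} → X φ → N4+ X φ
  sub : ∀ {φ} (σ : ℕ → Fm) → N4+ X φ → N4+ X (substF σ φ)
  mp  : ∀ {φ ψ} → N4+ X φ → N4+ X (φ ⇒ ψ) → N4+ X ψ

P Q : MFm
P = var 0
Q = var 1

data BS4Ax : MFm → Set where
  n4   : ∀ {φ} → N4Ax φ → BS4Ax (ι φ)
  lem  : BS4Ax (P ∨ ¬ᵐ P)
  □id  : BS4Ax (□ (P ⇒ P))
  □∧   : BS4Ax ((□ P ∧ □ Q) ⇒ □ (P ∧ Q))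
  axT  : BS4Ax (□ P ⇒ P)
  ax4  : BS4Ax (□ P ⇒ □ □ P)
  ¬□   : BS4Ax (¬ᵐ (□ P) ↔ᵐ ◇ (¬ᵐ P))
  ¬◇   : BS4Ax (¬ᵐ (◇ P) ↔ᵐ □ (¬ᵐ P))
  □dual : BS4Ax (□ P ⇔ᵐ ∼ ◇ ∼ P)
  ◇dual : BS4Ax (◇ P ⇔ᵐ ∼ □ ∼ P)

data BS4+ (Y : MFm → Set) : MFm → Set where
  ax   : ∀ {φ} → BS4Ax φ → BS4+ Y φ
  hyp  : ∀ {φ} → Y φ → BS4+ Y φ
  sub  : ∀ {φ} (σ : ℕ → MFm) → BS4+ Y φ → BS4+ Y (substM σ φ)
  mp   : ∀ {φ ψ} → BS4+ Y φ → BS4+ Y (φ ⇒ ψ) → BS4+ Y ψ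
  mono□ : ∀ {φ ψ} → BS4+ Y (φ ⇒ ψ) → BS4+ Y (□ φ ⇒ □ ψ)
  mono◇ : ∀ {φ ψ} → BS4+ Y (φ ⇒ ψ) → BS4+ Y (◇ φ ⇒ ◇ ψ)

BS4 : MFm → Set
BS4 = BS4+ (λ _ → Empty)

mutual
  TB : Fm → MFm
  TB (var n) = □ var n
  TB ⊥ = ⊥
  TB (φ ∧ ψ) = TB φ ∧ TB ψ
  TB (φ ∨ ψ) = TB φ ∨ TB ψ
  TB (φ ⇒ ψ) = □ (TB φ ⇒ TB ψ)
  TB (∼ φ) = TBn φ

  TBn : Fm → MFm
  TBn (var n) = □ ∼ var n
  TBn ⊥ = ∼ ⊥
  TBn (φ ∧ ψ) = TBn φ ∨ TBn ψ
  TBn (φ ∨ ψ) = TBn φ ∧ TBn ψ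
  TBn (φ ⇒ ψ) = TB φ ∧ TBn ψ
  TBn (∼ φ) = TB φ

τB : (Fm → Set) → MFm → Set
τB L = BS4+ (λ χ → Σ Fm (λ φ → L φ × (χ ≡ TB φ)))

IsModalLogic : (MFm → Set) → Set
IsModalLogic M =
  (∀ σ φ → M φ → M (substM σ φ)) ×
  (∀ φ ψ → M φ → M (φ ⇒ ψ) → M ψ) ×
  (∀ φ ψ → M (φ ⇒ ψ) → M (□ φ ⇒ □ ψ)) ×
  (∀ φ ψ → M (φ ⇒ ψ) → M (◇ φ ⇒ ◇ ψ))

IsModalCompanion : (Fm → Set) → (MFm → Set) → Set
IsModalCompanion L M =
  IsModalLogic M ×
  (∀ χ → BS4 χ → M χ) ×
  (∀ φ → (L φ → M (TB φ)) × (M (TB φ) → L φ))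

data IsInt : Fm → Set where
  var : ∀ n → IsInt (var n)
  ⊥ : IsInt ⊥
  _∧_ : ∀ {φ ψ} → IsInt φ → IsInt ψ → IsInt (φ ∧ ψ)
  _∨_ : ∀ {φ ψ} → IsInt φ → IsInt ψ → IsInt (φ ∨ ψ)
  _⇒_ : ∀ {φ ψ} → IsInt φ → IsInt ψ → IsInt (φ ⇒ ψ)

qSub : (ℕ → Bool) → ℕ → Fm
qSub isQ n = if isQ n then (var n ∨ ∼ var n) else var n

-- φ = ψ(p1..pn, q1 ∨ ∼q1, ..., qm ∨ ∼qm), ψ ∼-free, p's and q's disjoint
SpecialForm : Fm → Set
SpecialForm φ = Σ Fm (λ ψ → IsInt ψ × Σ (ℕ → Bool) (λ isQ → φ ≡ substF (qSub isQ) ψ))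

{-# OPTIONS --safe #-}
module Submission where

-- Let A be the Lindenbaum Heyting algebra of L and ∇ the filter of all elements
-- of the form φ ∨ ∼φ.  An axiom of the special form only says that ψ(a, d) = 1
-- for all a in A and d in ∇, so φ is valid under every twist valuation
-- p ↦ (a, b) with a ∨ b ∈ ∇.  Let B be the free Boolean extension of A, with the
-- interior operator □ whose open elements are A.  Since ∇ contains every a ∨ ¬a
-- and A generates B, it contains □x ∨ □¬x for all x in B; hence the pairs (x, y)
-- with □x ∨ □y ∈ ∇ form a twist structure closed under all modal operations,
-- i.e. a model of BS4.  In it TB φ takes the value of φ at the pairs (□x, □y), so
-- it is a model of τB L, and the valuation p ↦ (p, ∼p) refutes TB φ if φ ∉ L.

open import Defs
open import Data.Bool using (true; false; if_then_else_)
open import Data.List using (List; []; _∷_; _++_; cartesianProductWith)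
open import Data.List.Membership.Propositional using (_∈_)
open import Data.List.Membership.Propositional.Properties using (∈-++⁺ˡ; ∈-++⁺ʳ; ∈-++⁻; ∈-cartesianProductWith⁺; ∈-cartesianProductWith⁻)
open import Data.List.Relation.Unary.Any using (here; there)
open import Data.Nat using (ℕ)
open import Data.Product using (Σ; _×_; _,_; proj₁; proj₂; swap)
open import Data.Sum using ([_,_])
open import Function using (_∘_)
open import Level using (0ℓ)
open import Relation.Binary using (Rel; Reflexive; Transitive; Maximum; Minimum)
open import Relation.Binary.Lattice using (HeytingAlgebra; Supremum; Infimum; Exponential)
open import Relation.Binary.PropositionalEquality using (_≡_; refl; sym; cong; cong₂; subst)
import Relation.Binary.Lattice.Properties.HeytingAlgebra as HeytingProperties
import Relation.Binary.Lattice.Properties.JoinSemilattice as JoinProperties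
import Relation.Binary.Lattice.Properties.MeetSemilattice as MeetProperties

-- Heyting algebras and a calculus for their order.

Heyting : Set₁
Heyting = HeytingAlgebra 0ℓ 0ℓ 0ℓ

-- Equality is mutual inequality, so the algebras of formulas and of normal forms are built without
-- quotients.
heytingFromPreorder : {C : Set} {_≤_ : Rel C 0ℓ} {_∨′_ _∧′_ _⇨_ : C → C → C} {⊤′ ⊥′ : C} →
  Reflexive _≤_ → Transitive _≤_ → Supremum _≤_ _∨′_ → Infimum _≤_ _∧′_ →
  Exponential _≤_ _∧′_ _⇨_ → Maximum _≤_ ⊤′ → Minimum _≤_ ⊥′ → Heyting
heytingFromPreorder {_≤_ = _≤_} {_∨′_} {_∧′_} {_⇨_} {⊤′} {⊥′} rfl trs sup inf exp max min = record
  { _≈_ = λ x y → x ≤ y × y ≤ x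
  ; _≤_ = _≤_
  ; _∨_ = _∨′_
  ; _∧_ = _∧′_
  ; _⇨_ = _⇨_
  ; ⊤ = ⊤′
  ; ⊥ = ⊥′
  ; isHeytingAlgebra = record
    { isBoundedLattice = record
      { isLattice = record
        { isPartialOrder = record
          { isPreorder = record
            { isEquivalence = record
              { refl = rfl , rfl
              ; sym = swap
              ; trans = λ (a , b) (c , d) → trs a c , trs d b
              }
            ; reflexive = proj₁
            ; trans = trs
            }
          ; antisym = _,_
          }
        ; supremum = sup
        ; infimum = inf
        }
      ; maximum = max
      ; minimum = min
      }
    ; exponential = exp
    }
  }

-- Inequalities Γ ≤ a are proved in natural-deduction style, the left-hand side
-- being a meet of assumptions.
module Deduction (H : Heyting) where

  open HeytingAlgebra H public
    renaming (_∧_ to _⊓_; _∨_ to _⊔_; ⊤ to 𝟏; ⊥ to 𝟎; refl to ≤-refl; trans to ≤-trans; reflexive to ≤-reflexive)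
    using (Carrier; _≈_; _≤_; _⇨_; antisym; module Eq; joinSemilattice; meetSemilattice)
  open HeytingAlgebra H using (x∧y≤x; x∧y≤y; ∧-greatest; x≤x∨y; y≤x∨y; ∨-least; transpose-⇨; transpose-∧; maximum; minimum)
  open HeytingProperties H public using (⇨-cong)
  open JoinProperties joinSemilattice public using () renaming (∨-cong to ⊔-cong)
  open MeetProperties meetSemilattice public using () renaming (∧-cong to ⊓-cong)

  infix 8 −_

  −_ : Carrier → Carrier
  − a = a ⇨ 𝟎

  private variable
    Γ a b c : Carrier

  assume : Γ ⊓ a ≤ a
  assume = x∧y≤y _ _

  weaken : Γ ≤ b → Γ ⊓ a ≤ b
  weaken = ≤-trans (x∧y≤x _ _)

  ⊓-intro : Γ ≤ a → Γ ≤ b → Γ ≤ a ⊓ b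
  ⊓-intro = ∧-greatest

  ⊓-elim₁ : Γ ≤ a ⊓ b → Γ ≤ a
  ⊓-elim₁ h = ≤-trans h (x∧y≤x _ _)

  ⊓-elim₂ : Γ ≤ a ⊓ b → Γ ≤ b
  ⊓-elim₂ h = ≤-trans h (x∧y≤y _ _)

  ⊔-intro₁ : Γ ≤ a → Γ ≤ a ⊔ b
  ⊔-intro₁ h = ≤-trans h (x≤x∨y _ _)

  ⊔-intro₂ : Γ ≤ b → Γ ≤ a ⊔ b
  ⊔-intro₂ h = ≤-trans h (y≤x∨y _ _)

  ⇨-intro : Γ ⊓ a ≤ b → Γ ≤ a ⇨ b
  ⇨-intro = transpose-⇨

  ⇨-elim : Γ ≤ a ⇨ b → Γ ≤ a → Γ ≤ b
  ⇨-elim f h = ≤-trans (∧-greatest ≤-refl h) (transpose-∧ f)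

  -- Residuation moves the context `Γ` to the right of `⇨`; this is where distributivity comes from.
  ⊔-elim : Γ ≤ a ⊔ b → Γ ⊓ a ≤ c → Γ ⊓ b ≤ c → Γ ≤ c
  ⊔-elim h f g = ⇨-elim (≤-trans h (∨-least (swapped f) (swapped g))) ≤-refl
    where
    swapped : Γ ⊓ a ≤ c → a ≤ Γ ⇨ c
    swapped k = ⇨-intro (≤-trans (∧-greatest (x∧y≤y _ _) (x∧y≤x _ _)) k)

  ⊔-cases : a ≤ c → b ≤ c → a ⊔ b ≤ c
  ⊔-cases = ∨-least

  𝟏-intro : Γ ≤ 𝟏
  𝟏-intro = maximum _

  𝟎-elim : Γ ≤ 𝟎 → Γ ≤ a
  𝟎-elim h = ≤-trans h (minimum _)

  ⊔-mono : ∀ {a a′ b b′} → a ≤ a′ → b ≤ b′ → a ⊔ b ≤ a′ ⊔ b′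
  ⊔-mono f g = ⊔-cases (⊔-intro₁ f) (⊔-intro₂ g)

  ⊓-mono : ∀ {a a′ b b′} → a ≤ a′ → b ≤ b′ → a ⊓ b ≤ a′ ⊓ b′
  ⊓-mono f g = ⊓-intro (weaken f) (≤-trans assume g)

  −-anti : a ≤ b → − b ≤ − a
  −-anti h = ⇨-intro (⇨-elim (weaken ≤-refl) (≤-trans assume h))

-- Twist semantics of N4 over a Heyting algebra.

module Twist (H : Heyting) (u⁺ u⁻ : ℕ → HeytingAlgebra.Carrier H) where

  open Deduction H

  mutual
    pos : Fm → Carrier
    pos (var n) = u⁺ n
    pos ⊥ = 𝟎
    pos (φ ∧ ψ) = pos φ ⊓ pos ψ
    pos (φ ∨ ψ) = pos φ ⊔ pos ψ
    pos (φ ⇒ ψ) = pos φ ⇨ pos ψ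
    pos (∼ φ) = neg φ

    neg : Fm → Carrier
    neg (var n) = u⁻ n
    neg ⊥ = 𝟏
    neg (φ ∧ ψ) = neg φ ⊔ neg ψ
    neg (φ ∨ ψ) = neg φ ⊓ neg ψ
    neg (φ ⇒ ψ) = pos φ ⊓ neg ψ
    neg (∼ φ) = pos φ

  N4Ax-valid : ∀ {φ} → N4Ax φ → 𝟏 ≤ pos φ
  N4Ax-valid ax1 = ⇨-intro (⇨-intro (weaken assume))
  N4Ax-valid ax2 = ⇨-intro (⇨-intro (⇨-intro
    (⇨-elim (⇨-elim (weaken (weaken assume)) assume) (⇨-elim (weaken assume) assume))))
  N4Ax-valid ax3 = ⇨-intro (⊓-elim₁ assume)
  N4Ax-valid ax4 = ⇨-intro (⊓-elim₂ assume)
  N4Ax-valid ax5 = ⇨-intro (⇨-intro (⊓-intro (weaken assume) assume))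
  N4Ax-valid ax6 = ⇨-intro (⊔-intro₁ assume)
  N4Ax-valid ax7 = ⇨-intro (⊔-intro₂ assume)
  N4Ax-valid ax8 = ⇨-intro (⇨-intro (⇨-intro (⊔-elim assume
    (⇨-elim (weaken (weaken (weaken assume))) assume)
    (⇨-elim (weaken (weaken assume)) assume))))
  N4Ax-valid ax9 = ⇨-intro (𝟎-elim assume)
  N4Ax-valid n∨ = ⊓-intro (⇨-intro assume) (⇨-intro assume)
  N4Ax-valid n∧ = ⊓-intro (⇨-intro assume) (⇨-intro assume)
  N4Ax-valid n⇒ = ⊓-intro (⇨-intro assume) (⇨-intro assume)
  N4Ax-valid n∼ = ⊓-intro (⇨-intro assume) (⇨-intro assume)
  N4Ax-valid n⊥ = ≤-refl

module _ (H : Heyting) (u⁺ u⁻ : ℕ → HeytingAlgebra.Carrier H) (σ : ℕ → Fm) where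

  open Deduction H
  open Twist H u⁺ u⁻
  private module σ = Twist H (pos ∘ σ) (neg ∘ σ)

  mutual
    pos-subst : ∀ φ → pos (substF σ φ) ≡ σ.pos φ
    pos-subst (var n) = refl
    pos-subst ⊥ = refl
    pos-subst (φ ∧ ψ) = cong₂ _⊓_ (pos-subst φ) (pos-subst ψ)
    pos-subst (φ ∨ ψ) = cong₂ _⊔_ (pos-subst φ) (pos-subst ψ)
    pos-subst (φ ⇒ ψ) = cong₂ _⇨_ (pos-subst φ) (pos-subst ψ)
    pos-subst (∼ φ) = neg-subst φ

    neg-subst : ∀ φ → neg (substF σ φ) ≡ σ.neg φ
    neg-subst (var n) = refl
    neg-subst ⊥ = refl
    neg-subst (φ ∧ ψ) = cong₂ _⊔_ (neg-subst φ) (neg-subst ψ)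
    neg-subst (φ ∨ ψ) = cong₂ _⊓_ (neg-subst φ) (neg-subst ψ)
    neg-subst (φ ⇒ ψ) = cong₂ _⊓_ (pos-subst φ) (neg-subst ψ)
    neg-subst (∼ φ) = pos-subst φ

-- Equivalently, a filter containing every element whose pseudocomplement is `𝟎`. It determines the
-- twist structure of all pairs (a, b) with a ⊔ b in `∇`.
record DenseFilter (H : Heyting) : Set₁ where
  open Deduction H
  field
    ∇ : Carrier → Set
    upward : ∀ {a b} → a ≤ b → ∇ a → ∇ b
    meet : ∀ {a b} → ∇ a → ∇ b → ∇ (a ⊓ b)
    dense : ∀ a → ∇ (a ⊔ − a)

  ∇-𝟏 : ∇ 𝟏
  ∇-𝟏 = upward 𝟏-intro (dense 𝟏)

module N4Soundness {H : Heyting} (F : DenseFilter H) where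

  open Deduction H
  open DenseFilter F

  Valid : Fm → Set
  Valid φ = ∀ u⁺ u⁻ → (∀ n → ∇ (u⁺ n ⊔ u⁻ n)) → 𝟏 ≤ Twist.pos H u⁺ u⁻ φ

  module _ (u⁺ u⁻ : ℕ → Carrier) (balanced : ∀ n → ∇ (u⁺ n ⊔ u⁻ n)) where

    open Twist H u⁺ u⁻

    ∇-twist : ∀ φ → ∇ (pos φ ⊔ neg φ)
    ∇-twist (var n) = balanced n
    ∇-twist ⊥ = upward (⊔-intro₂ ≤-refl) ∇-𝟏
    ∇-twist (φ ∧ ψ) = upward
      (⊔-elim (⊓-elim₁ ≤-refl)
        (⊔-elim (weaken (⊓-elim₂ ≤-refl))
          (⊔-intro₁ (⊓-intro (weaken assume) assume))
          (⊔-intro₂ (⊔-intro₂ assume)))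
        (⊔-intro₂ (⊔-intro₁ assume)))
      (meet (∇-twist φ) (∇-twist ψ))
    ∇-twist (φ ∨ ψ) = upward
      (⊔-elim (⊓-elim₁ ≤-refl)
        (⊔-intro₁ (⊔-intro₁ assume))
        (⊔-elim (weaken (⊓-elim₂ ≤-refl))
          (⊔-intro₁ (⊔-intro₂ assume))
          (⊔-intro₂ (⊓-intro (weaken assume) assume))))
      (meet (∇-twist φ) (∇-twist ψ))
    -- Density at `pos φ` splits the claim: under its pseudocomplement the implication holds, and
    -- under `pos φ` the balance of ψ decides.
    ∇-twist (φ ⇒ ψ) = upward
      (⊔-elim (⊓-elim₁ ≤-refl)
        (⊔-elim (weaken (⊓-elim₂ ≤-refl))
          (⊔-intro₁ (⇨-intro (weaken assume)))
          (⊔-intro₂ (⊓-intro (weaken assume) assume)))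
        (⊔-intro₁ (⇨-intro (𝟎-elim (⇨-elim (weaken assume) assume)))))
      (meet (dense (pos φ)) (∇-twist ψ))
    ∇-twist (∼ φ) = upward (⊔-cases (⊔-intro₂ ≤-refl) (⊔-intro₁ ≤-refl)) (∇-twist φ)

  N4-sound : ∀ {X} → (∀ φ → X φ → Valid φ) → ∀ {φ} → N4+ X φ → Valid φ
  N4-sound hX (ax α) u⁺ u⁻ bal = Twist.N4Ax-valid H u⁺ u⁻ α
  N4-sound hX (hyp h) = hX _ h
  N4-sound hX (sub {φ} σ d) u⁺ u⁻ bal =
    -- The placeholders are the valuation `pos ∘ σ`, `neg ∘ σ`, which `∇-twist` shows to be
    -- admissible.
    subst (𝟏 ≤_) (sym (pos-subst H u⁺ u⁻ σ φ)) (N4-sound hX d _ _ (∇-twist u⁺ u⁻ bal ∘ σ))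
  N4-sound hX (mp d e) u⁺ u⁻ bal = ⇨-elim (N4-sound hX e u⁺ u⁻ bal) (N4-sound hX d u⁺ u⁻ bal)

-- Interior algebras and balanced pairs.

-- An interior algebra B whose algebra of open elements is A, the interior
-- operator being split into the embedding ↑ and its right adjoint □.
record BooleanExtension (A : Heyting) : Set₁ where
  field
    B : Heyting
  private
    module A = Deduction A
    module B = Deduction B
  field
    stable : ∀ x → B.− B.− x B.≤ x
    ↑ : A.Carrier → B.Carrier
    int : B.Carrier → A.Carrier
    ↑⊣int : ∀ {a x} → ↑ a B.≤ x → a A.≤ int x
    int⊢↑ : ∀ {a x} → a A.≤ int x → ↑ a B.≤ x
    ↑-⊓ : ∀ {a b} → ↑ a B.⊓ ↑ b B.≤ ↑ (a A.⊓ b)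
    ↑-𝟏 : B.𝟏 B.≤ ↑ A.𝟏
    int-↑ : ∀ {a} → int (↑ a) A.≤ a

module Interior {A : Heyting} (E : BooleanExtension A) where

  open BooleanExtension E
  private
    module A = Deduction A
    module B = Deduction B
  open B using (−_)

  ↑-mono : ∀ {a b} → a A.≤ b → ↑ a B.≤ ↑ b
  ↑-mono h = int⊢↑ (A.≤-trans h (↑⊣int B.≤-refl))

  int-mono : ∀ {x y} → x B.≤ y → int x A.≤ int y
  int-mono h = ↑⊣int (B.≤-trans (int⊢↑ A.≤-refl) h)

  ↑int≤ : ∀ {x} → ↑ (int x) B.≤ x
  ↑int≤ = int⊢↑ A.≤-refl

  int-⊓ : ∀ {x y} → int x A.⊓ int y A.≤ int (x B.⊓ y)
  int-⊓ = ↑⊣int (B.⊓-intro (B.≤-trans (↑-mono (A.⊓-elim₁ A.≤-refl)) ↑int≤)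
                           (B.≤-trans (↑-mono (A.⊓-elim₂ A.≤-refl)) ↑int≤))

  ↑-⊓-≈ : ∀ a b → ↑ (a A.⊓ b) B.≈ ↑ a B.⊓ ↑ b
  ↑-⊓-≈ a b = B.antisym
    (B.⊓-intro (↑-mono (A.⊓-elim₁ A.≤-refl)) (↑-mono (A.⊓-elim₂ A.≤-refl))) ↑-⊓

  -- Left adjoints preserve joins and the bottom; for meets and the top, preservation is a field of
  -- the record.
  ↑-⊔-≈ : ∀ a b → ↑ (a A.⊔ b) B.≈ ↑ a B.⊔ ↑ b
  ↑-⊔-≈ a b = B.antisym
    (int⊢↑ (A.⊔-cases (↑⊣int (B.⊔-intro₁ B.≤-refl)) (↑⊣int (B.⊔-intro₂ B.≤-refl))))
    (B.⊔-cases (↑-mono (A.⊔-intro₁ A.≤-refl)) (↑-mono (A.⊔-intro₂ A.≤-refl)))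

  ↑-𝟎-≈ : ↑ A.𝟎 B.≈ B.𝟎
  ↑-𝟎-≈ = B.antisym (int⊢↑ (A.𝟎-elim A.≤-refl)) (B.𝟎-elim B.≤-refl)

  ↑-𝟏-≈ : ↑ A.𝟏 B.≈ B.𝟏
  ↑-𝟏-≈ = B.antisym B.𝟏-intro ↑-𝟏

  -- This justifies the box that `TB` puts on implications. Both directions carry modus ponens
  -- across the adjunction; the second returns to `A` by `int-↑`.
  ↑-⇨-≈ : ∀ a b → ↑ (a A.⇨ b) B.≈ ↑ (int (↑ a B.⇨ ↑ b))
  ↑-⇨-≈ a b = B.antisym
    (↑-mono (↑⊣int (B.⇨-intro (B.≤-trans ↑-⊓ (↑-mono (A.⇨-elim (A.weaken A.≤-refl) A.assume))))))
    (↑-mono (A.⇨-intro (A.≤-trans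
      (↑⊣int (B.≤-trans (B.≤-reflexive (↑-⊓-≈ _ _))
        (B.⇨-elim (B.weaken ↑int≤) B.assume)))
      int-↑)))

  excluded-middle : ∀ x → B.𝟏 B.≤ x B.⊔ − x
  excluded-middle x = B.≤-trans
    (B.⇨-intro (B.⇨-elim B.assume
      (B.⊔-intro₂ (B.⇨-intro (B.⇨-elim (B.weaken B.assume) (B.⊔-intro₁ B.assume))))))
    (stable _)

  □ᴮ ◇ᴮ : B.Carrier → B.Carrier
  □ᴮ x = ↑ (int x)
  ◇ᴮ x = − □ᴮ (− x)

  □ᴮ-mono : ∀ {x y} → x B.≤ y → □ᴮ x B.≤ □ᴮ y
  □ᴮ-mono = ↑-mono ∘ int-mono

  ◇ᴮ-mono : ∀ {x y} → x B.≤ y → ◇ᴮ x B.≤ ◇ᴮ y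
  ◇ᴮ-mono h = B.−-anti (□ᴮ-mono (B.−-anti h))

  ≤-stable : ∀ {x} → x B.≤ − − x
  ≤-stable = B.⇨-intro (B.⇨-elim B.assume (B.weaken B.≤-refl))

  ≤◇ᴮ : ∀ {x} → x B.≤ ◇ᴮ x
  ≤◇ᴮ = B.⇨-intro (B.⇨-elim (B.≤-trans B.assume ↑int≤) (B.weaken B.≤-refl))

  module Balance (F : DenseFilter A) where

    open DenseFilter F

    Balanced : B.Carrier → B.Carrier → Set
    Balanced x y = ∇ (int x A.⊔ int y)

    balanced-mono : ∀ {x x′ y y′} → x B.≤ x′ → y B.≤ y′ → Balanced x y → Balanced x′ y′
    balanced-mono f g = upward (A.⊔-mono (int-mono f) (int-mono g))

    balanced-swap : ∀ {x y} → Balanced x y → Balanced y x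
    balanced-swap = upward (A.⊔-cases (A.⊔-intro₂ A.≤-refl) (A.⊔-intro₁ A.≤-refl))

    -- The interior preserves meets but in general only satisfies int y ⊔ int w ≤ int (y ⊔ w); that
    -- inequality suffices, `∇` being upward closed.
    balanced-⊓ : ∀ {x y z w} → Balanced x y → Balanced z w → Balanced (x B.⊓ z) (y B.⊔ w)
    balanced-⊓ h k = upward
      (A.⊔-elim (A.⊓-elim₁ A.≤-refl)
        (A.⊔-elim (A.weaken (A.⊓-elim₂ A.≤-refl))
          (A.⊔-intro₁ (A.≤-trans (A.⊓-intro (A.weaken A.assume) A.assume) int-⊓))
          (A.⊔-intro₂ (A.≤-trans A.assume (int-mono (B.⊔-intro₂ B.≤-refl)))))
        (A.⊔-intro₂ (A.≤-trans A.assume (int-mono (B.⊔-intro₁ B.≤-refl)))))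
      (meet h k)

    balanced-𝟎𝟏 : Balanced B.𝟎 B.𝟏
    balanced-𝟎𝟏 = upward (A.⊔-intro₂ (↑⊣int B.𝟏-intro)) ∇-𝟏

    -- Since ¬x ⊔ z ≤ x ⇨ z, this reduces to the meet of the pairs (x, ¬x) and (w, z).
    balanced-⇨ : ∀ {x z w} → Balanced x (− x) → Balanced z w → Balanced (x B.⇨ z) (x B.⊓ w)
    balanced-⇨ h k = balanced-swap (balanced-mono B.≤-refl
      (B.⊔-cases (B.⇨-intro (B.𝟎-elim (B.⇨-elim (B.weaken B.≤-refl) B.assume)))
                 (B.⇨-intro (B.weaken B.≤-refl)))
      (balanced-⊓ h (balanced-swap k)))

    balanced-□◇ : ∀ {x y} → Balanced x y → Balanced (□ᴮ x) (◇ᴮ y)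
    balanced-□◇ = upward (A.⊔-mono (↑⊣int B.≤-refl) (int-mono ≤◇ᴮ))

-- Modal twist semantics of BS4 and the value of translations.

module ModalTwist {A : Heyting} (E : BooleanExtension A) (v⁺ v⁻ : ℕ → HeytingAlgebra.Carrier (BooleanExtension.B E)) where

  open BooleanExtension E
  open Interior E
  open Deduction B
  private
    module A = Deduction A
    module T = Twist A (int ∘ v⁺) (int ∘ v⁻)

  mutual
    posᵐ : MFm → Carrier
    posᵐ (var n) = v⁺ n
    posᵐ ⊥ = 𝟎
    posᵐ (φ ∧ ψ) = posᵐ φ ⊓ posᵐ ψ
    posᵐ (φ ∨ ψ) = posᵐ φ ⊔ posᵐ ψ
    posᵐ (φ ⇒ ψ) = posᵐ φ ⇨ posᵐ ψ
    posᵐ (∼ φ) = negᵐ φ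
    posᵐ (□ φ) = □ᴮ (posᵐ φ)
    posᵐ (◇ φ) = ◇ᴮ (posᵐ φ)

    negᵐ : MFm → Carrier
    negᵐ (var n) = v⁻ n
    negᵐ ⊥ = 𝟏
    negᵐ (φ ∧ ψ) = negᵐ φ ⊔ negᵐ ψ
    negᵐ (φ ∨ ψ) = negᵐ φ ⊓ negᵐ ψ
    negᵐ (φ ⇒ ψ) = posᵐ φ ⊓ negᵐ ψ
    negᵐ (∼ φ) = posᵐ φ
    negᵐ (□ φ) = ◇ᴮ (negᵐ φ)
    negᵐ (◇ φ) = □ᴮ (negᵐ φ)

  mutual
    posᵐ-ι : ∀ φ → posᵐ (ι φ) ≡ Twist.pos B v⁺ v⁻ φ
    posᵐ-ι (var n) = refl
    posᵐ-ι ⊥ = refl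
    posᵐ-ι (φ ∧ ψ) = cong₂ _⊓_ (posᵐ-ι φ) (posᵐ-ι ψ)
    posᵐ-ι (φ ∨ ψ) = cong₂ _⊔_ (posᵐ-ι φ) (posᵐ-ι ψ)
    posᵐ-ι (φ ⇒ ψ) = cong₂ _⇨_ (posᵐ-ι φ) (posᵐ-ι ψ)
    posᵐ-ι (∼ φ) = negᵐ-ι φ

    negᵐ-ι : ∀ φ → negᵐ (ι φ) ≡ Twist.neg B v⁺ v⁻ φ
    negᵐ-ι (var n) = refl
    negᵐ-ι ⊥ = refl
    negᵐ-ι (φ ∧ ψ) = cong₂ _⊔_ (negᵐ-ι φ) (negᵐ-ι ψ)
    negᵐ-ι (φ ∨ ψ) = cong₂ _⊓_ (negᵐ-ι φ) (negᵐ-ι ψ)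
    negᵐ-ι (φ ⇒ ψ) = cong₂ _⊓_ (posᵐ-ι φ) (negᵐ-ι ψ)
    negᵐ-ι (∼ φ) = posᵐ-ι φ

  ≤⇒𝟏≤⇨ : ∀ {x y} → x ≤ y → 𝟏 ≤ x ⇨ y
  ≤⇒𝟏≤⇨ h = ⇨-intro (≤-trans assume h)

  𝟏≤⇨⇒≤ : ∀ {x y} → 𝟏 ≤ x ⇨ y → x ≤ y
  𝟏≤⇨⇒≤ h = ⇨-elim (≤-trans 𝟏-intro h) ≤-refl

  BS4Ax-valid : ∀ {φ} → BS4Ax φ → 𝟏 ≤ posᵐ φ
  BS4Ax-valid (n4 {φ} α) = subst (𝟏 ≤_) (sym (posᵐ-ι φ)) (Twist.N4Ax-valid B v⁺ v⁻ α)
  BS4Ax-valid lem = excluded-middle _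
  BS4Ax-valid □id = ≤-trans ↑-𝟏 (↑-mono (↑⊣int (⇨-intro assume)))
  BS4Ax-valid □∧ = ≤⇒𝟏≤⇨ (≤-trans ↑-⊓ (↑-mono int-⊓))
  BS4Ax-valid axT = ≤⇒𝟏≤⇨ ↑int≤
  BS4Ax-valid ax4 = ≤⇒𝟏≤⇨ (↑-mono (↑⊣int ≤-refl))
  BS4Ax-valid ¬□ = ⊓-intro (≤⇒𝟏≤⇨ (−-anti (□ᴮ-mono (stable _)))) (≤⇒𝟏≤⇨ (−-anti (□ᴮ-mono ≤-stable)))
  BS4Ax-valid ¬◇ = ⊓-intro (≤⇒𝟏≤⇨ (stable _)) (≤⇒𝟏≤⇨ ≤-stable)
  -- In both duality axioms the two sides compute to the same element, as `negᵐ` exchanges `□ᴮ` and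
  -- `◇ᴮ`.
  BS4Ax-valid □dual = ⊓-intro (⊓-intro (≤⇒𝟏≤⇨ ≤-refl) (≤⇒𝟏≤⇨ ≤-refl)) (⊓-intro (≤⇒𝟏≤⇨ ≤-refl) (≤⇒𝟏≤⇨ ≤-refl))
  BS4Ax-valid ◇dual = ⊓-intro (⊓-intro (≤⇒𝟏≤⇨ ≤-refl) (≤⇒𝟏≤⇨ ≤-refl)) (⊓-intro (≤⇒𝟏≤⇨ ≤-refl) (≤⇒𝟏≤⇨ ≤-refl))

  mutual
    -- Translations take open values: `↑` preserves the lattice operations, and `↑-⇨-≈` treats
    -- implication.
    posᵐ-TB : ∀ φ → posᵐ (TB φ) ≈ ↑ (T.pos φ)
    posᵐ-TB (var n) = Eq.refl
    posᵐ-TB ⊥ = Eq.sym ↑-𝟎-≈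
    posᵐ-TB (φ ∧ ψ) = Eq.trans (⊓-cong (posᵐ-TB φ) (posᵐ-TB ψ)) (Eq.sym (↑-⊓-≈ _ _))
    posᵐ-TB (φ ∨ ψ) = Eq.trans (⊔-cong (posᵐ-TB φ) (posᵐ-TB ψ)) (Eq.sym (↑-⊔-≈ _ _))
    posᵐ-TB (φ ⇒ ψ) = Eq.trans (□ᴮ-cong (⇨-cong (posᵐ-TB φ) (posᵐ-TB ψ))) (Eq.sym (↑-⇨-≈ _ _))
      where
      □ᴮ-cong : ∀ {x y} → x ≈ y → □ᴮ x ≈ □ᴮ y
      □ᴮ-cong h = antisym (□ᴮ-mono (≤-reflexive h)) (□ᴮ-mono (≤-reflexive (Eq.sym h)))
    posᵐ-TB (∼ φ) = posᵐ-TBn φ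

    posᵐ-TBn : ∀ φ → posᵐ (TBn φ) ≈ ↑ (T.neg φ)
    posᵐ-TBn (var n) = Eq.refl
    posᵐ-TBn ⊥ = Eq.sym ↑-𝟏-≈
    posᵐ-TBn (φ ∧ ψ) = Eq.trans (⊔-cong (posᵐ-TBn φ) (posᵐ-TBn ψ)) (Eq.sym (↑-⊔-≈ _ _))
    posᵐ-TBn (φ ∨ ψ) = Eq.trans (⊓-cong (posᵐ-TBn φ) (posᵐ-TBn ψ)) (Eq.sym (↑-⊓-≈ _ _))
    posᵐ-TBn (φ ⇒ ψ) = Eq.trans (⊓-cong (posᵐ-TB φ) (posᵐ-TBn ψ)) (Eq.sym (↑-⊓-≈ _ _))
    posᵐ-TBn (∼ φ) = posᵐ-TB φ

  TB-valid⁺ : ∀ φ → A.𝟏 A.≤ T.pos φ → 𝟏 ≤ posᵐ (TB φ)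
  TB-valid⁺ φ h = ≤-trans ↑-𝟏 (≤-trans (↑-mono h) (≤-reflexive (Eq.sym (posᵐ-TB φ))))

  TB-valid⁻ : ∀ φ → 𝟏 ≤ posᵐ (TB φ) → A.𝟏 A.≤ T.pos φ
  TB-valid⁻ φ h = A.≤-trans (↑⊣int (≤-trans 𝟏-intro (≤-trans h (≤-reflexive (posᵐ-TB φ))))) int-↑

module _ {A : Heyting} (E : BooleanExtension A) (v⁺ v⁻ : ℕ → HeytingAlgebra.Carrier (BooleanExtension.B E)) (σ : ℕ → MFm) where

  open BooleanExtension E
  open Interior E
  open Deduction B
  open ModalTwist E v⁺ v⁻
  private module σ = ModalTwist E (posᵐ ∘ σ) (negᵐ ∘ σ)

  mutual
    posᵐ-subst : ∀ φ → posᵐ (substM σ φ) ≡ σ.posᵐ φ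
    posᵐ-subst (var n) = refl
    posᵐ-subst ⊥ = refl
    posᵐ-subst (φ ∧ ψ) = cong₂ _⊓_ (posᵐ-subst φ) (posᵐ-subst ψ)
    posᵐ-subst (φ ∨ ψ) = cong₂ _⊔_ (posᵐ-subst φ) (posᵐ-subst ψ)
    posᵐ-subst (φ ⇒ ψ) = cong₂ _⇨_ (posᵐ-subst φ) (posᵐ-subst ψ)
    posᵐ-subst (∼ φ) = negᵐ-subst φ
    posᵐ-subst (□ φ) = cong □ᴮ (posᵐ-subst φ)
    posᵐ-subst (◇ φ) = cong ◇ᴮ (posᵐ-subst φ)

    negᵐ-subst : ∀ φ → negᵐ (substM σ φ) ≡ σ.negᵐ φ
    negᵐ-subst (var n) = refl
    negᵐ-subst ⊥ = refl
    negᵐ-subst (φ ∧ ψ) = cong₂ _⊔_ (negᵐ-subst φ) (negᵐ-subst ψ)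
    negᵐ-subst (φ ∨ ψ) = cong₂ _⊓_ (negᵐ-subst φ) (negᵐ-subst ψ)
    negᵐ-subst (φ ⇒ ψ) = cong₂ _⊓_ (posᵐ-subst φ) (negᵐ-subst ψ)
    negᵐ-subst (∼ φ) = posᵐ-subst φ
    negᵐ-subst (□ φ) = cong ◇ᴮ (negᵐ-subst φ)
    negᵐ-subst (◇ φ) = cong □ᴮ (negᵐ-subst φ)

-- `settled` serves the implication case of `balanced-twist`. It can fail if the open elements do
-- not generate `B`: take the four-element algebra with only 0 and 1 open and `∇` consisting of 1.
module BS4Soundness {A : Heyting} (E : BooleanExtension A) (F : DenseFilter A)
  (settled : ∀ x → Interior.Balance.Balanced E F x (Deduction.−_ (BooleanExtension.B E) x)) where

  open BooleanExtension E
  open Interior E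
  open Balance F
  open Deduction B

  Validᵐ : MFm → Set
  Validᵐ χ = ∀ v⁺ v⁻ → (∀ n → Balanced (v⁺ n) (v⁻ n)) → 𝟏 ≤ ModalTwist.posᵐ E v⁺ v⁻ χ

  module _ (v⁺ v⁻ : ℕ → Carrier) (balanced : ∀ n → Balanced (v⁺ n) (v⁻ n)) where

    open ModalTwist E v⁺ v⁻

    balanced-twist : ∀ χ → Balanced (posᵐ χ) (negᵐ χ)
    balanced-twist (var n) = balanced n
    balanced-twist ⊥ = balanced-𝟎𝟏
    balanced-twist (φ ∧ ψ) = balanced-⊓ (balanced-twist φ) (balanced-twist ψ)
    balanced-twist (φ ∨ ψ) = balanced-swap
      (balanced-⊓ (balanced-swap (balanced-twist φ)) (balanced-swap (balanced-twist ψ)))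
    balanced-twist (φ ⇒ ψ) = balanced-⇨ (settled (posᵐ φ)) (balanced-twist ψ)
    balanced-twist (∼ φ) = balanced-swap (balanced-twist φ)
    balanced-twist (□ φ) = balanced-□◇ (balanced-twist φ)
    balanced-twist (◇ φ) = balanced-swap (balanced-□◇ (balanced-swap (balanced-twist φ)))

  BS4-sound : ∀ {Y} → (∀ χ → Y χ → Validᵐ χ) → ∀ {χ} → BS4+ Y χ → Validᵐ χ
  BS4-sound hY (ax α) v⁺ v⁻ bal = ModalTwist.BS4Ax-valid E v⁺ v⁻ α
  BS4-sound hY (hyp h) = hY _ h
  BS4-sound hY (sub {χ} σ d) v⁺ v⁻ bal =
    subst (𝟏 ≤_) (sym (posᵐ-subst E v⁺ v⁻ σ χ)) (BS4-sound hY d _ _ (balanced-twist v⁺ v⁻ bal ∘ σ))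
  BS4-sound hY (mp d e) v⁺ v⁻ bal = ⇨-elim (BS4-sound hY e v⁺ v⁻ bal) (BS4-sound hY d v⁺ v⁻ bal)
  BS4-sound hY (mono□ d) v⁺ v⁻ bal = ≤⇒𝟏≤⇨ (□ᴮ-mono (𝟏≤⇨⇒≤ (BS4-sound hY d v⁺ v⁻ bal)))
    where open ModalTwist E v⁺ v⁻
  BS4-sound hY (mono◇ d) v⁺ v⁻ bal = ≤⇒𝟏≤⇨ (◇ᴮ-mono (𝟏≤⇨⇒≤ (BS4-sound hY d v⁺ v⁻ bal)))
    where open ModalTwist E v⁺ v⁻

-- Conjunctive normal forms over a Heyting algebra.

-- The free Boolean extension of A in conjunctive normal form: a list of cells
-- (c , d) stands for the meet of the clauses ¬c ∨ d.  A cell w = (e , f) also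
-- serves as the test element e ∧ ¬f, and w # k says that e ∧ ¬f lies below the
-- clause k, i.e. that the cells w and k are disjoint.
module FreeExtension (A : Heyting) where

  open Deduction A

  Cell : Set
  Cell = Carrier × Carrier

  -- The meet of two test elements, and at the same time the join of two clauses: a cell read as a
  -- clause is the complement of the same cell read as a test.
  _·_ : Cell → Cell → Cell
  (e , f) · (c , d) = e ⊓ c , f ⊔ d

  infix 4 _#_ _⊩_ _≤ᴮ_

  _#_ : Cell → Cell → Set
  (e , f) # (c , d) = e ⊓ c ≤ f ⊔ d

  -- With `(e , f) # (c , d)` read as the sequent e, c ⊢ f, d, the lemmas up to contraction are
  -- structural rules.
  #-sym : ∀ w k → w # k → k # w
  #-sym w k h = ≤-trans (⊓-intro assume (weaken ≤-refl))
    (≤-trans h (⊔-cases (⊔-intro₂ ≤-refl) (⊔-intro₁ ≤-refl)))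

  #-assoc : ∀ w k j → (w · k) # j → w # (k · j)
  #-assoc w k j h = ≤-trans
    (⊓-intro (⊓-intro (weaken ≤-refl) (⊓-elim₁ assume)) (⊓-elim₂ assume))
    (≤-trans h (⊔-cases (⊔-mono ≤-refl (⊔-intro₁ ≤-refl)) (⊔-intro₂ (⊔-intro₂ ≤-refl))))

  #-assoc⁻ : ∀ w k j → w # (k · j) → (w · k) # j
  #-assoc⁻ w k j h = ≤-trans
    (⊓-intro (weaken (weaken ≤-refl)) (⊓-intro (weaken assume) assume))
    (≤-trans h (⊔-cases (⊔-intro₁ (⊔-intro₁ ≤-refl)) (⊔-mono (⊔-intro₂ ≤-refl) ≤-refl)))

  #-swap : ∀ w k j → (w · k) # j → (w · j) # k
  #-swap w k j h = ≤-trans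
    (⊓-intro (⊓-intro (weaken (weaken ≤-refl)) assume) (weaken assume))
    (≤-trans h (⊔-cases (⊔-mono (⊔-intro₁ ≤-refl) ≤-refl) (⊔-intro₁ (⊔-intro₂ ≤-refl))))

  #-weakenʳ : ∀ w k j → w # j → (w · k) # j
  #-weakenʳ w k j h = ≤-trans (⊓-mono (weaken ≤-refl) ≤-refl)
    (≤-trans h (⊔-mono (⊔-intro₁ ≤-refl) ≤-refl))

  #-weakenˡ : ∀ w k j → k # j → (w · k) # j
  #-weakenˡ w k j h = ≤-trans (⊓-mono assume ≤-refl)
    (≤-trans h (⊔-mono (⊔-intro₂ ≤-refl) ≤-refl))

  #-contractʳ : ∀ w k → (w · k) # k → w # k
  #-contractʳ w k h = ≤-trans (⊓-intro ≤-refl assume) (≤-trans h (⊔-cases ≤-refl (⊔-intro₂ ≤-refl)))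

  #-contractˡ : ∀ w k → (w · w) # k → w # k
  #-contractˡ w k h = ≤-trans (⊓-mono (⊓-intro ≤-refl ≤-refl) ≤-refl)
    (≤-trans h (⊔-mono (⊔-cases ≤-refl ≤-refl) ≤-refl))

  _⊩_ : Cell → List Cell → Set
  w ⊩ x = ∀ k → k ∈ x → w # k

  -- Every element of the free Boolean extension is a finite join of elements e ∧ ¬f, so such tests
  -- determine the order.
  _≤ᴮ_ : List Cell → List Cell → Set
  x ≤ᴮ y = ∀ w → w ⊩ x → w ⊩ y

  -- The top as a test, the bottom as a clause.
  unit : Cell
  unit = 𝟏 , 𝟎

  #-unit : ∀ w k → w # unit → w # k
  #-unit w k h = weaken (⊔-intro₁ (≤-trans (⊓-intro ≤-refl 𝟏-intro) (≤-trans h (⊔-cases ≤-refl (𝟎-elim ≤-refl)))))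

  #-unit⁻ : ∀ w k → w # k → (w · k) # unit
  #-unit⁻ w k h = weaken (⊔-intro₁ h)

  #-unit⁺ : ∀ w k → (w · k) # unit → w # k
  #-unit⁺ w k h = ≤-trans (⊓-intro ≤-refl 𝟏-intro) (≤-trans h (⊔-cases ≤-refl (𝟎-elim ≤-refl)))

  _∨ᴮ_ : List Cell → List Cell → List Cell
  _∨ᴮ_ = cartesianProductWith _·_

  ∨ᴮ-intro : ∀ w x y → (∀ k → k ∈ x → (w · k) ⊩ y) → w ⊩ x ∨ᴮ y
  ∨ᴮ-intro w x y h _ m with k , j , k∈x , j∈y , refl ← ∈-cartesianProductWith⁻ _·_ x y m =
    #-assoc w k j (h k k∈x j j∈y)

  ∨ᴮ-elim : ∀ w x y → w ⊩ x ∨ᴮ y → ∀ k → k ∈ x → (w · k) ⊩ y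
  ∨ᴮ-elim w x y h k k∈x j j∈y = #-assoc⁻ w k j (h _ (∈-cartesianProductWith⁺ _·_ k∈x j∈y))

  -- De Morgan: the complement c ∧ ¬d of a clause consists of the clauses `(𝟏 , c)` and `(d , 𝟎)`,
  -- and complements of clauses are joined.
  negate : List Cell → List Cell
  negate [] = unit ∷ []
  negate ((c , d) ∷ x) = ((𝟏 , c) ∷ (d , 𝟎) ∷ []) ∨ᴮ negate x

  negate-intro : ∀ w x → (∀ k → k ⊩ x → w # k) → w ⊩ negate x
  negate-intro w [] h _ (here refl) = h unit (λ _ ())
  negate-intro w ((c , d) ∷ x) h = ∨ᴮ-intro w ((𝟏 , c) ∷ (d , 𝟎) ∷ []) (negate x) λ where
    -- As tests, the two possible cells `k` are ¬c and d, the disjuncts of the head clause; each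
    -- lies below it, so `h` applies to `k · j`.
    k (here refl) → negate-intro _ x λ j j⊩x → #-assoc⁻ w k j (h (k · j) λ where
      _ (here refl) → ≤-trans assume (⊔-intro₁ (⊔-intro₁ ≤-refl))
      i (there m) → #-weakenˡ k j i (j⊩x i m))
    k (there (here refl)) → negate-intro _ x λ j j⊩x → #-assoc⁻ w k j (h (k · j) λ where
      _ (here refl) → weaken (weaken (⊔-intro₂ ≤-refl))
      i (there m) → #-weakenˡ k j i (j⊩x i m))

  negate-elim : ∀ w x → w ⊩ negate x → ∀ k → k ⊩ x → w # k
  negate-elim w [] h k _ = #-unit w k (h _ (here refl))
  negate-elim w ((c , d) ∷ x) h k k⊩ =
    -- Two cuts: `below-or-c` yields c on the right, the head clause turns it into d, and
    -- `below-unless-d` consumes d on the left.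
    ⊔-elim (≤-trans (⊓-mono (⊓-intro ≤-refl 𝟏-intro) ≤-refl) below-or-c)
      (⊔-elim assume
        (⊔-intro₁ assume)
        (⊔-elim (≤-trans (⊓-intro (weaken (weaken assume)) assume) (k⊩ _ (here refl)))
          (⊔-intro₂ assume)
          (≤-trans
            (≤-trans (⊓-intro (⊓-intro (weaken (weaken (weaken (weaken ≤-refl)))) assume)
                              (weaken (weaken (weaken assume))))
                     below-unless-d)
            (⊔-mono (⊔-cases ≤-refl (𝟎-elim ≤-refl)) ≤-refl))))
      (⊔-intro₂ assume)
    where
    negate-rest : ∀ j → j ∈ (𝟏 , c) ∷ (d , 𝟎) ∷ [] → (w · j) # k
    negate-rest j m = negate-elim (w · j) x
      (∨ᴮ-elim w ((𝟏 , c) ∷ (d , 𝟎) ∷ []) (negate x) h j m) k (λ i → k⊩ i ∘ there)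
    below-or-c = negate-rest _ (here refl)
    below-unless-d = negate-rest _ (there (here refl))

  _⇨ᴮ_ : List Cell → List Cell → List Cell
  x ⇨ᴮ y = negate x ∨ᴮ y

  ⇨ᴮ-intro : ∀ w x y → (∀ k → k ⊩ x → (w · k) ⊩ y) → w ⊩ x ⇨ᴮ y
  ⇨ᴮ-intro w x y h = ∨ᴮ-intro w (negate x) y λ j j∈ k k∈y → #-swap w k j
    (negate-intro (w · k) x (λ i i⊩x → #-swap w i k (h i i⊩x k k∈y)) j j∈)

  ⇨ᴮ-elim : ∀ w x y → w ⊩ x ⇨ᴮ y → ∀ k → k ⊩ x → (w · k) ⊩ y
  ⇨ᴮ-elim w x y h k k⊩x j j∈y = #-swap w j k (negate-elim (w · j) x
    (λ i i∈ → #-swap w i j (∨ᴮ-elim w (negate x) y h i i∈ j j∈y)) k k⊩x)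

  𝟎ᴮ : List Cell
  𝟎ᴮ = unit ∷ []

  boolean : Heyting
  boolean = heytingFromPreorder {C = List Cell} {_≤_ = _≤ᴮ_} {_∨ᴮ_} {_++_} {_⇨ᴮ_} {[]} {𝟎ᴮ}
    (λ w h → h) (λ f g w h → g w (f w h))
    (λ x y →
        (λ w w⊩x → ∨ᴮ-intro w x y λ k k∈x j _ → #-unit (w · k) j (#-unit⁻ w k (w⊩x k k∈x)))
      , (λ w w⊩y → ∨ᴮ-intro w x y λ k _ j j∈y → #-weakenʳ w k j (w⊩y j j∈y))
      -- The test `w · k` is the part of `w` outside the clause `k`. It lies below `x`, hence below
      -- `z`, hence is empty.
      , (λ z x≤z y≤z w h k k∈z → #-contractʳ w k (x≤z (w · k)
          (λ j j∈x → #-swap w j k (y≤z (w · j) (∨ᴮ-elim w x y h j j∈x) k k∈z)) k k∈z)))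
    (λ x y →
        (λ w h k k∈x → h k (∈-++⁺ˡ k∈x))
      , (λ w h k k∈y → h k (∈-++⁺ʳ x k∈y))
      , (λ z z≤x z≤y w h k k∈ → [ z≤x w h k , z≤y w h k ] (∈-++⁻ x k∈)))
    (λ z x y →
        (λ f w w⊩z → ⇨ᴮ-intro w x y λ k k⊩x → f (w · k) λ j j∈ →
          [ (λ j∈z → #-weakenʳ w k j (w⊩z j j∈z)) , (λ j∈x → #-weakenˡ w k j (k⊩x j j∈x)) ] (∈-++⁻ z j∈))
      , (λ f w h k k∈y → #-contractˡ w k
          (⇨ᴮ-elim w x y (f w λ j j∈z → h j (∈-++⁺ˡ j∈z)) w (λ j j∈x → h j (∈-++⁺ʳ z j∈x)) k k∈y)))
    (λ x w h k ())
    (λ x w h k _ → #-unit w k (h unit (here refl)))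

  -- The largest open element below ¬c ∨ d is c ⇨ d, and interiors commute with meets: conjunctive
  -- normal form makes the interior computable.
  interior : List Cell → Carrier
  interior [] = 𝟏
  interior ((c , d) ∷ x) = (c ⇨ d) ⊓ interior x

  ≤-interior⁺ : ∀ {a} x → (∀ c d → (c , d) ∈ x → a ⊓ c ≤ d) → a ≤ interior x
  ≤-interior⁺ [] h = 𝟏-intro
  ≤-interior⁺ ((c , d) ∷ x) h = ⊓-intro (⇨-intro (h c d (here refl)))
    (≤-interior⁺ x λ c d m → h c d (there m))

  ≤-interior⁻ : ∀ {a} x → a ≤ interior x → ∀ c d → (c , d) ∈ x → a ⊓ c ≤ d
  ≤-interior⁻ ((c , d) ∷ x) h _ _ (here refl) = ⇨-elim (weaken (⊓-elim₁ h)) assume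
  ≤-interior⁻ ((c , d) ∷ x) h c′ d′ (there m) = ≤-interior⁻ x (⊓-elim₂ h) c′ d′ m

  embed : Carrier → List Cell
  embed a = (𝟏 , a) ∷ []

  ⊩-embed⁺ : ∀ {e f a} → e ≤ f ⊔ a → (e , f) ⊩ embed a
  ⊩-embed⁺ h _ (here refl) = weaken h

  ⊩-embed⁻ : ∀ {e f a} → (e , f) ⊩ embed a → e ≤ f ⊔ a
  ⊩-embed⁻ h = ≤-trans (⊓-intro ≤-refl 𝟏-intro) (h _ (here refl))

  extension : BooleanExtension A
  extension = record
    { B = boolean
    ; stable = λ x w h k k∈x → #-unit⁺ w k (⇨ᴮ-elim w (x ⇨ᴮ 𝟎ᴮ) 𝟎ᴮ h k
        (⇨ᴮ-intro k x 𝟎ᴮ λ { j j⊩x _ (here refl) → #-unit⁻ k j (#-sym j k (j⊩x k k∈x)) })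
        unit (here refl))
    ; ↑ = embed
    ; int = interior
    ; ↑⊣int = λ {a} {x} h → ≤-interior⁺ x λ c d m → ≤-trans
        -- The test `(a , 𝟎)` is the embedded `a` itself.
        (h (a , 𝟎) (⊩-embed⁺ (⊔-intro₂ ≤-refl)) (c , d) m) (⊔-cases (𝟎-elim ≤-refl) ≤-refl)
    ; int⊢↑ = λ {a} {x} h w w⊩a (c , d) m → ⊔-elim (weaken (⊩-embed⁻ w⊩a))
        (⊔-intro₁ assume)
        (⊔-intro₂ (≤-trans (⊓-intro assume (weaken assume)) (≤-interior⁻ x h c d m)))
    ; ↑-⊓ = λ w h → ⊩-embed⁺ (⊔-elim (⊩-embed⁻ λ k m → h k (∈-++⁺ˡ m))
        (⊔-intro₁ assume)
        (⊔-elim (weaken (⊩-embed⁻ λ k m → h k (∈-++⁺ʳ (embed _) m)))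
          (⊔-intro₁ assume)
          (⊔-intro₂ (⊓-intro (weaken assume) assume))))
    ; ↑-𝟏 = λ w _ → ⊩-embed⁺ (⊔-intro₂ 𝟏-intro)
    ; int-↑ = ⇨-elim (⊓-elim₁ ≤-refl) 𝟏-intro
    }

  module _ (F : DenseFilter A) where

    open DenseFilter F
    open Interior extension
    open Balance F

    -- Density at c and d leaves three cases: ¬c and d each give c ⇨ d, while c ⊓ ¬d is an open
    -- element below the complement of the clause.
    settled-clause : ∀ c d → Balanced ((c , d) ∷ []) (((c , d) ∷ []) ⇨ᴮ 𝟎ᴮ)
    settled-clause c d = upward
      (⊔-elim (⊓-elim₁ ≤-refl)
        (⊔-elim (weaken (⊓-elim₂ ≤-refl))
          (⊔-intro₁ (⊓-intro (⇨-intro (weaken assume)) 𝟏-intro))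
          (⊔-intro₂ (≤-trans (⊓-intro (weaken assume) assume) refuted)))
        (⊔-intro₁ (⊓-intro (⇨-intro (𝟎-elim (⇨-elim (weaken assume) assume))) 𝟏-intro)))
      (meet (dense c) (dense d))
      where
      refuted : c ⊓ − d ≤ interior (((c , d) ∷ []) ⇨ᴮ 𝟎ᴮ)
      refuted = BooleanExtension.↑⊣int extension {x = ((c , d) ∷ []) ⇨ᴮ 𝟎ᴮ}
        λ w w⊩ → ⇨ᴮ-intro w ((c , d) ∷ []) 𝟎ᴮ λ where
          k k⊩ _ (here refl) → #-unit⁻ w k (⊔-elim (weaken (⊩-embed⁻ w⊩))
            (⊔-intro₁ assume)
            (⊔-elim (≤-trans (⊓-intro (weaken assume) (⊓-elim₁ assume)) (k⊩ _ (here refl)))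
              (⊔-intro₂ assume)
              (𝟎-elim (⇨-elim (weaken (⊓-elim₂ assume)) assume))))

    -- Induction over the clauses: this is where generation of the extension by `A` enters. Meets
    -- are handled by `balanced-⊓`, because ¬k ∨ ¬x ≤ ¬(k ∧ x).
    settled : ∀ x → Balanced x (x ⇨ᴮ 𝟎ᴮ)
    settled [] = upward (⊔-intro₁ ≤-refl) ∇-𝟏
    settled (k@(c , d) ∷ x) = balanced-mono {k ∷ x} {k ∷ x} {((k ∷ []) ⇨ᴮ 𝟎ᴮ) ∨ᴮ (x ⇨ᴮ 𝟎ᴮ)} {(k ∷ x) ⇨ᴮ 𝟎ᴮ}
      (λ w h → h)
      (B.⊔-cases {(k ∷ []) ⇨ᴮ 𝟎ᴮ} {(k ∷ x) ⇨ᴮ 𝟎ᴮ} {x ⇨ᴮ 𝟎ᴮ}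
        (B.−-anti {k ∷ x} {k ∷ []} λ { w h j (here m) → h j (here m) })
        (B.−-anti {k ∷ x} {x} λ w h j m → h j (there m)))
      (balanced-⊓ {k ∷ []} {(k ∷ []) ⇨ᴮ 𝟎ᴮ} {x} {x ⇨ᴮ 𝟎ᴮ} (settled-clause c d) (settled x))
      where module B = Deduction boolean

-- The Lindenbaum algebra and its filter of dichotomies.

module Lindenbaum (X : Fm → Set) where

  private
    instantiate : Fm → Fm → Fm → ℕ → Fm
    instantiate a b c 0 = a
    instantiate a b c 1 = b
    instantiate a b c _ = c

    axiom : ∀ {φ} → N4Ax φ → (a b c : Fm) → N4+ X (substF (instantiate a b c) φ)
    axiom α a b c = sub (instantiate a b c) (ax α)

    constant : ∀ {a b} → N4+ X b → N4+ X (a ⇒ b)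
    constant {a} {b} d = mp d (axiom ax1 b a a)

    apply : ∀ {a b c} → N4+ X (a ⇒ (b ⇒ c)) → N4+ X (a ⇒ b) → N4+ X (a ⇒ c)
    apply {a} {b} {c} f d = mp d (mp f (axiom ax2 a b c))

    identity : ∀ {a} → N4+ X (a ⇒ a)
    identity {a} = apply (axiom ax1 a (a ⇒ a) a) (axiom ax1 a a a)

    compose : ∀ {a b c} → N4+ X (a ⇒ b) → N4+ X (b ⇒ c) → N4+ X (a ⇒ c)
    compose f g = apply (constant g) f

  algebra : Heyting
  algebra = heytingFromPreorder {C = Fm} {_≤_ = λ a b → N4+ X (a ⇒ b)} {_∨_} {_∧_} {_⇒_} {⊥ ⇒ ⊥} {⊥}
    identity compose
    (λ a b → axiom ax6 a b b , axiom ax7 a b b , λ c f g → mp g (mp f (axiom ax8 a b c)))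
    (λ a b → axiom ax3 a b b , axiom ax4 a b b , λ c f g → apply (compose f (axiom ax5 a b b)) g)
    (λ c a b →
        (λ f → compose (axiom ax5 c a a) (mp (constant f) (axiom ax2 a (c ∧ a) b)))
      , (λ f → apply (compose (axiom ax3 c a a) f) (axiom ax4 c a a)))
    (λ a → constant identity)
    (λ a → axiom ax9 a a a)

  open Deduction algebra

  theorem⇒𝟏≤ : ∀ {φ} → N4+ X φ → 𝟏 ≤ φ
  theorem⇒𝟏≤ = constant

  𝟏≤⇒theorem : ∀ {φ} → 𝟏 ≤ φ → N4+ X φ
  𝟏≤⇒theorem = mp identity

  private
    equivalence : ∀ {a b} → N4+ X (a ↔ b) → a ≈ b
    equivalence d = mp d (axiom ax3 _ _ ⊥) , mp d (axiom ax4 _ _ ⊥)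

  ∼∨-≈ : ∀ a b → ∼ (a ∨ b) ≈ ∼ a ∧ ∼ b
  ∼∨-≈ a b = equivalence (axiom n∨ a b ⊥)

  ∼∧-≈ : ∀ a b → ∼ (a ∧ b) ≈ ∼ a ∨ ∼ b
  ∼∧-≈ a b = equivalence (axiom n∧ a b ⊥)

  ∼⇒-≈ : ∀ a b → ∼ (a ⇒ b) ≈ a ∧ ∼ b
  ∼⇒-≈ a b = equivalence (axiom n⇒ a b ⊥)

  ∼∼-≈ : ∀ a → ∼ ∼ a ≈ a
  ∼∼-≈ a = equivalence (axiom n∼ a ⊥ ⊥)

  ∼⊥-≈ : ∼ ⊥ ≈ 𝟏
  ∼⊥-≈ = 𝟏-intro , constant (ax n⊥)

  module _ {u⁺ u⁻ : ℕ → Fm} (h⁺ : ∀ n → u⁺ n ≈ var n) (h⁻ : ∀ n → u⁻ n ≈ ∼ var n) where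

    open Twist algebra u⁺ u⁻

    mutual
      -- The truth lemma for p ↦ (p, ∼p). The valuation is fixed only up to `≈` because it will be
      -- met in the form `int (↑ (var n))`.
      pos-≈ : ∀ φ → pos φ ≈ φ
      pos-≈ (var n) = h⁺ n
      pos-≈ ⊥ = Eq.refl
      pos-≈ (φ ∧ ψ) = ⊓-cong (pos-≈ φ) (pos-≈ ψ)
      pos-≈ (φ ∨ ψ) = ⊔-cong (pos-≈ φ) (pos-≈ ψ)
      pos-≈ (φ ⇒ ψ) = ⇨-cong (pos-≈ φ) (pos-≈ ψ)
      pos-≈ (∼ φ) = neg-≈ φ

      neg-≈ : ∀ φ → neg φ ≈ ∼ φ
      neg-≈ (var n) = h⁻ n
      neg-≈ ⊥ = Eq.sym ∼⊥-≈
      neg-≈ (φ ∧ ψ) = Eq.trans (⊔-cong (neg-≈ φ) (neg-≈ ψ)) (Eq.sym (∼∧-≈ φ ψ))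
      neg-≈ (φ ∨ ψ) = Eq.trans (⊓-cong (neg-≈ φ) (neg-≈ ψ)) (Eq.sym (∼∨-≈ φ ψ))
      neg-≈ (φ ⇒ ψ) = Eq.trans (⊓-cong (pos-≈ φ) (neg-≈ ψ)) (Eq.sym (∼⇒-≈ φ ψ))
      neg-≈ (∼ φ) = Eq.trans (pos-≈ φ) (Eq.sym (∼∼-≈ φ))

  dichotomy : Fm → Fm
  dichotomy φ = φ ∨ ∼ φ

  ∼dichotomy≤dichotomy : ∀ φ → ∼ dichotomy φ ≤ dichotomy φ
  ∼dichotomy≤dichotomy φ = ≤-trans (≤-reflexive (∼∨-≈ φ (∼ φ))) (⊔-intro₂ (⊓-elim₁ ≤-refl))

  -- Equivalent to dichotomy φ, but with an inconsistent strong negation.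
  sharp : Fm → Fm
  sharp φ = dichotomy φ ∨ ∼ (¬ dichotomy φ)

  sharp≤dichotomy : ∀ φ → sharp φ ≤ dichotomy φ
  sharp≤dichotomy φ = ⊔-cases ≤-refl (≤-trans (≤-reflexive (∼⇒-≈ _ _)) (⊓-elim₁ ≤-refl))

  -- For the dichotomy D of φ, the left side reduces to ∼D ∧ ¬D, and ∼D ≤ D.
  ∼sharp≤𝟎 : ∀ φ → ∼ sharp φ ≤ 𝟎
  ∼sharp≤𝟎 φ = ≤-trans (≤-reflexive (∼∨-≈ _ _))
    (⇨-elim (≤-trans assume (≤-reflexive (∼∼-≈ _))) (weaken (∼dichotomy≤dichotomy φ)))

  filter : DenseFilter algebra
  filter = record
    { ∇ = λ a → Σ Fm λ φ → dichotomy φ ≤ a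
    ; upward = λ a≤b (φ , h) → φ , ≤-trans h a≤b
    -- The strong negation of this witness is inconsistent, so its dichotomy is no larger than the
    -- witness itself.
    ; meet = λ (φ , h) (ψ , k) → sharp φ ∧ sharp ψ , ⊔-cases
        (⊓-mono (≤-trans (sharp≤dichotomy φ) h) (≤-trans (sharp≤dichotomy ψ) k))
        (𝟎-elim (≤-trans (≤-reflexive (∼∧-≈ _ _)) (⊔-cases (∼sharp≤𝟎 φ) (∼sharp≤𝟎 ψ))))
    -- ∼¬a is equivalent to a, so the dichotomy of ¬a is ¬a ∨ a.
    ; dense = λ a → ¬ a , ⊔-cases (⊔-intro₂ ≤-refl)
        (⊔-intro₁ (≤-trans (≤-reflexive (∼⇒-≈ _ _)) (⊓-elim₁ ≤-refl)))
    }

  open DenseFilter filter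

  -- Upward closure adds nothing. `a` alone is no witness, as ∼a need not lie below it; joining a
  -- dichotomy below `a` changes nothing up to `≈` but forces the strong negation below `a`.
  ∇⇒dichotomy : ∀ {a} → ∇ a → Σ Fm λ θ → dichotomy θ ≈ a
  ∇⇒dichotomy {a} (φ , h) = a ∨ dichotomy φ , antisym
    (⊔-cases (⊔-cases ≤-refl h)
      (≤-trans (≤-reflexive (∼∨-≈ _ _))
        (≤-trans assume (≤-trans (∼dichotomy≤dichotomy φ) h))))
    (⊔-intro₁ (⊔-intro₁ ≤-refl))

  -- Each value u⁺ ⊔ u⁻ of q ∨ ∼q is the dichotomy of some formula. Substituting that formula for q,
  -- and u⁺ for each p, turns the axiom into the theorem that its value is `𝟏`; as ψ is ∼-free,
  -- positive parts suffice.
  special-valid : ∀ φ → SpecialForm φ → X φ → N4Soundness.Valid filter φ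
  special-valid _ (ψ , int , isQ , refl) x u⁺ u⁻ bal =
    ≤-trans (theorem⇒𝟏≤ (sub σ (hyp x))) (≤-reflexive (evaluates int))
    where
    open Twist algebra u⁺ u⁻

    σ : ℕ → Fm
    σ n = if isQ n then proj₁ (∇⇒dichotomy (bal n)) else u⁺ n

    evaluates : ∀ {χ} → IsInt χ → substF σ (substF (qSub isQ) χ) ≈ pos (substF (qSub isQ) χ)
    evaluates (var n) with isQ n in eq
    ... | true rewrite eq = proj₂ (∇⇒dichotomy (bal n))
    ... | false rewrite eq = Eq.refl
    evaluates ⊥ = Eq.refl
    evaluates (i ∧ j) = ⊓-cong (evaluates i) (evaluates j)
    evaluates (i ∨ j) = ⊔-cong (evaluates i) (evaluates j)
    evaluates (i ⇒ j) = ⇨-cong (evaluates i) (evaluates j)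

-- Faithfulness of the translation.

theorem4p1p5 : (L X : Fm → Set) →
    (∀ φ → X φ → SpecialForm φ) →
    (∀ φ → (L φ → N4+ X φ) × (N4+ X φ → L φ)) →
    IsModalCompanion L (τB L)
theorem4p1p5 L X special axiomatized =
  ((λ σ _ → sub σ) , (λ _ _ → mp) , (λ _ _ → mono□) , (λ _ _ → mono◇)) ,
  (λ _ → BS4⊆τB) ,
  λ φ → (λ l → hyp (φ , l , refl)) , proj₂ (axiomatized φ) ∘ faithful φ
  where
  open Lindenbaum X
  open Deduction algebra
  open FreeExtension algebra using (extension; settled)
  open BooleanExtension extension
  open N4Soundness filter
  open BS4Soundness extension filter (settled filter)

  BS4⊆τB : ∀ {χ} → BS4 χ → τB L χ
  BS4⊆τB (ax α) = ax α
  BS4⊆τB (sub σ d) = sub σ (BS4⊆τB d)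
  BS4⊆τB (mp d e) = mp (BS4⊆τB d) (BS4⊆τB e)
  BS4⊆τB (mono□ d) = mono□ (BS4⊆τB d)
  BS4⊆τB (mono◇ d) = mono◇ (BS4⊆τB d)

  -- A balanced valuation has interiors admissible for N4 validity, by the very definition of
  -- `Balanced`; so `N4-sound` makes each translated theorem of `L` valid.
  τB-sound : ∀ {χ} → τB L χ → Validᵐ χ
  τB-sound = BS4-sound λ { _ (φ , l , refl) v⁺ v⁻ bal → ModalTwist.TB-valid⁺ extension v⁺ v⁻ φ
    (N4-sound (λ ψ x → special-valid ψ (special ψ x) x) (proj₁ (axiomatized φ) l) _ _ bal) }

  int-↑-≈ : ∀ a → int (↑ a) ≈ a
  int-↑-≈ a = antisym (int-↑ {a}) (↑⊣int {a} {↑ a} λ w h → h)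

  v⁺ v⁻ : ℕ → Deduction.Carrier B
  v⁺ n = ↑ (var n)
  v⁻ n = ↑ (∼ var n)

  faithful : ∀ φ → τB L (TB φ) → N4+ X φ
  faithful φ d = 𝟏≤⇒theorem (≤-trans
    -- The canonical pairs are balanced, with `var n` itself supplying the required dichotomy.
    (ModalTwist.TB-valid⁻ extension v⁺ v⁻ φ (τB-sound d v⁺ v⁻ λ n → var n ,
      ⊔-mono (≤-reflexive (Eq.sym (int-↑-≈ (var n)))) (≤-reflexive (Eq.sym (int-↑-≈ (∼ var n))))))
    (≤-reflexive (pos-≈ (λ n → int-↑-≈ (var n)) (λ n → int-↑-≈ (∼ var n)) φ)))
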